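{- The integer $W_{10501} = \dfrac{2^{10501}+1}{3}$ is prime.
   Context: For an odd prime $p$, the Wagstaff number is $W_p = (2^p+1)/3$, which is an integer. -}

module Defs where

open import Data.Nat using (ℕ; _+_; _^_)
open import Data.Nat.DivMod using (_/_)

-- Wagstaff number W_p = (2^p + 1) / 3 (exact division for odd p)
W : ℕ → ℕ
W p = (2 ^ p + 1) / 3

{-# OPTIONS --safe #-}
{-
Write n = 1 + F R with F a product of primes ps.  If x = a ^ R satisfies x ^ F ≡ 1 (mod n) and
x ^ (F / p) - 1 is a unit mod n for every p in ps, then x has order F modulo every prime q ∣ n,
so F ∣ q - 1 by Fermat, and every divisor of n is ≡ 1 (mod F) (Pocklington).  A proper factorisation
would therefore be n = (1 + a F) (1 + b F) with a, b ≥ 1, that is a b F + (a + b) = R = s F + r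
in base F; as a + b ≤ 1 + a b, this is impossible when 1 + s < r (Brillhart-Lehmer-Selfridge).
This needs F only slightly above the cube root of n.

For n = W 10501, n - 1 = 2 (2 ^ 10500 - 1) / 3, and 10500 = 2² · 3 · 5³ · 7 has many divisors d,
so the (Aurifeuillian) factors of the cyclotomic values Φ_d(2) provide enough prime factors.
The largest one used is Φ_5250(2) itself: it equals Φ_210(x) at x = 2 ^ 25, and the polynomial
Φ_210(x) - 1 is divisible by x (x⁸ - 1) (x² + x + 1) (x² - x + 1).
-}
module Submission where

open import Defs
import Algebra.Properties.CommutativeSemiring.Binomial as Binomial
import Algebra.Properties.Monoid.Mult as Mult
import Algebra.Properties.Monoid.Sum as Sum
import Algebra.Properties.Semiring.Exp as Exp
open import Data.Bool using (Bool; false; if_then_else_; _∧_; T)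
open import Data.Bool.Properties using (T-∧)
open import Data.Fin using (Fin; zero; suc; toℕ; inject₁; fromℕ)
open import Data.Fin.Properties using (toℕ<n; toℕ-inject₁; toℕ-fromℕ)
open import Data.List using (List; []; _∷_)
open import Data.List.Relation.Unary.All using (All; []; _∷_)
open import Data.List.Relation.Unary.All.Properties using (replicate⁺)
open import Data.Nat
open import Data.Nat.Combinatorics using (_C_; nCn≡1; nCk≡nC[n∸k]; k![n∸k]!∣n!)
open import Data.Nat.Combinatorics.Specification using (nCk≡n!/k![n-k]!)
open import Data.Nat.Coprimality using (Coprime; coprime-Bézout)
open import Data.Nat.Divisibility
open import Data.Nat.DivMod
open import Data.Nat.GCD using (gcd; gcd-greatest; module Bézout)
open import Data.Nat.ListAction using (product)
open import Data.Nat.Primality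
open import Data.Nat.Primality.Factorisation using (factorise; module PrimeFactorisation)
open import Data.Nat.Properties
open import Data.Nat.Tactic.RingSolver using (solve-∀)
open import Data.Product using (_×_; _,_; proj₁; proj₂; ∃-syntax)
open import Data.Sum using (inj₁; inj₂; [_,_]′)
open import Function using (_∘_; id; Equivalence)
open import Relation.Binary.PropositionalEquality
open import Relation.Nullary using (¬_; contradiction; yes; no)
open import Relation.Nullary.Decidable using (True; toWitness)

-- Congruences and powers modulo `q`

module _ (q : ℕ) .{{_ : NonZero q}} where

  *-cong-% : ∀ {a b c d} → a % q ≡ b % q → c % q ≡ d % q → (a * c) % q ≡ (b * d) % q
  *-cong-% {a} {b} {c} {d} a≡b c≡d = begin
    (a * c) % q             ≡⟨ %-distribˡ-* a c q ⟩
    (a % q * (c % q)) % q   ≡⟨ cong₂ (λ u v → (u * v) % q) a≡b c≡d ⟩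
    (b % q * (d % q)) % q   ≡⟨ %-distribˡ-* b d q ⟨
    (b * d) % q             ∎
    where open ≡-Reasoning

  ^-cong-% : ∀ {a b} k → a % q ≡ b % q → (a ^ k) % q ≡ (b ^ k) % q
  ^-cong-% zero    a≡b = refl
  ^-cong-% (suc k) a≡b = *-cong-% a≡b (^-cong-% k a≡b)

  +-cong-% : ∀ {a b c d} → a % q ≡ b % q → c % q ≡ d % q → (a + c) % q ≡ (b + d) % q
  +-cong-% {a} {b} {c} {d} a≡b c≡d = begin
    (a + c) % q             ≡⟨ %-distribˡ-+ a c q ⟩
    (a % q + (c % q)) % q   ≡⟨ cong₂ (λ u v → (u + v) % q) a≡b c≡d ⟩
    (b % q + (d % q)) % q   ≡⟨ %-distribˡ-+ b d q ⟨
    (b + d) % q             ∎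
    where open ≡-Reasoning

  ^-one-% : ∀ {a} k → a % q ≡ 1 % q → (a ^ k) % q ≡ 1 % q
  ^-one-% k a≡1 = trans (^-cong-% k a≡1) (cong (_% q) (^-zeroˡ k))

  ≡1⇒∣∸1 : .{{NonTrivial q}} → ∀ y → y % q ≡ 1 % q → q ∣ y ∸ 1
  ≡1⇒∣∸1 y y≡1 = divides (y / q) (cong (_∸ 1) (begin
    y                   ≡⟨ m≡m%n+[m/n]*n y q ⟩
    y % q + y / q * q   ≡⟨ cong (_+ y / q * q) (trans y≡1 (m<n⇒m%n≡m (nonTrivial⇒n>1 q))) ⟩
    1 + y / q * q       ∎))
    where open ≡-Reasoning

  ^-*-≡1 : ∀ {a} m k → a ^ m % q ≡ 1 % q → a ^ (k * m) % q ≡ 1 % q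
  ^-*-≡1 {a} m k aᵐ≡1 = begin
    a ^ (k * m) % q   ≡⟨ cong (λ e → a ^ e % q) (*-comm k m) ⟩
    a ^ (m * k) % q   ≡⟨ cong (_% q) (^-*-assoc a m k) ⟨
    (a ^ m) ^ k % q   ≡⟨ ^-one-% k aᵐ≡1 ⟩
    1 % q             ∎
    where open ≡-Reasoning

  -- A Bézout identity written without subtraction: `a` times a power that is 1 equals another power
  -- that is 1. Both sign cases of Bézout reduce to this one.
  ^-consecutive-≡1 : ∀ {a} m n u v → 1 + v * n ≡ u * m →
                     a ^ m % q ≡ 1 % q → a ^ n % q ≡ 1 % q → a % q ≡ 1 % q
  ^-consecutive-≡1 {a} m n u v 1+vn≡um aᵐ≡1 aⁿ≡1 = begin
    a % q                   ≡⟨ cong (_% q) (*-identityʳ a) ⟨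
    (a * 1) % q             ≡⟨ *-cong-% {a} refl (^-*-≡1 n v aⁿ≡1) ⟨
    (a ^ (1 + v * n)) % q   ≡⟨ cong (λ e → a ^ e % q) 1+vn≡um ⟩
    (a ^ (u * m)) % q       ≡⟨ ^-*-≡1 m u aᵐ≡1 ⟩
    1 % q                   ∎
    where open ≡-Reasoning

  ^-coprime-≡1 : ∀ {a m n} → Coprime m n →
                 a ^ m % q ≡ 1 % q → a ^ n % q ≡ 1 % q → a % q ≡ 1 % q
  ^-coprime-≡1 {m = m} {n} coprime aᵐ≡1 aⁿ≡1 with coprime-Bézout coprime
  ... | Bézout.+- u v 1+vn≡um = ^-consecutive-≡1 m n u v 1+vn≡um aᵐ≡1 aⁿ≡1
  ... | Bézout.-+ u v 1+um≡vn = ^-consecutive-≡1 n m v u 1+um≡vn aⁿ≡1 aᵐ≡1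

-- Binomial coefficients modulo a prime and Fermat's little theorem

prime∤⇒coprime : ∀ {p n} → Prime p → ¬ p ∣ n → Coprime p n
prime∤⇒coprime pr p∤n (d∣p , d∣n) =
  [ id , (λ { refl → contradiction d∣n p∤n }) ]′ (prime⇒irreducible pr d∣p)

prime∤! : ∀ {p} → Prime p → ∀ {k} → k < p → ¬ p ∣ k !
prime∤! pr {zero}  _     p∣1 = nonTrivial⇒≢1 {{prime⇒nonTrivial pr}} (∣1⇒≡1 p∣1)
prime∤! pr {suc k} k+1<p p∣[k+1]! =
  [ (λ p∣k+1 → <⇒≱ k+1<p (∣⇒≤ p∣k+1))
  , prime∤! pr (<-trans (n<1+n k) k+1<p)
  ]′ (euclidsLemma (suc k) (k !) pr p∣[k+1]!)

-- `p` divides `p !`, which is the binomial coefficient times two factorials of numbers below `p`;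
-- by Euclid's lemma it must divide the coefficient.
prime∣C : ∀ {p} → Prime p → ∀ {k} → 0 < k → k < p → p ∣ p C k
prime∣C {p} pr {k} 0<k k<p =
  [ id
  , (λ p∣k![p-k]! → contradiction (euclidsLemma (k !) ((p ∸ k) !) pr p∣k![p-k]!)
      [ prime∤! pr k<p , prime∤! pr (∸-monoʳ-< 0<k (<⇒≤ k<p)) ]′)
  ]′ (euclidsLemma (p C k) (k ! * (p ∸ k) !) pr (subst (p ∣_) p!≡ (n∣n! p {{prime⇒nonZero pr}})))
  where
  instance _ = k !* (p ∸ k) !≢0
  p!≡ : p ! ≡ (p C k) * (k ! * (p ∸ k) !)
  p!≡ = begin
    p !
      ≡⟨ m/n*n≡m (k![n∸k]!∣n! (<⇒≤ k<p)) ⟨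
    p ! / (k ! * (p ∸ k) !) * (k ! * (p ∸ k) !)
      ≡⟨ cong (_* (k ! * (p ∸ k) !)) (nCk≡n!/k![n-k]! (<⇒≤ k<p)) ⟨
    (p C k) * (k ! * (p ∸ k) !)
      ∎
    where open ≡-Reasoning
  n∣n! : ∀ n .{{_ : NonZero n}} → n ∣ n !
  n∣n! (suc n) = m∣m*n (n !)

module ℕ-Binomial = Binomial +-*-commutativeSemiring
module ℕ-Mult = Mult +-0-monoid
module ℕ-Sum = Sum +-0-monoid
module ℕ-Exp = Exp +-*-semiring

-- The binomial theorem is phrased with generic multiples and powers; this and `^≡^` translate them
-- to arithmetic on ℕ.
×≡* : ∀ c x → c ℕ-Mult.× x ≡ c * x
×≡* zero    x = refl
×≡* (suc c) x = cong (x +_) (×≡* c x)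

^≡^ : ∀ x k → x ℕ-Exp.^ k ≡ x ^ k
^≡^ x zero    = refl
^≡^ x (suc k) = cong (x *_) (^≡^ x k)

∣sum : ∀ {d n} (t : Fin n → ℕ) → (∀ i → d ∣ t i) → d ∣ ℕ-Sum.sum t
∣sum {n = zero}  t d∣t = _ ∣0
∣sum {n = suc n} t d∣t = ∣m∣n⇒∣m+n (d∣t zero) (∣sum (t ∘ suc) (d∣t ∘ suc))

freshman's-dream : ∀ {p} .{{_ : NonZero p}} → Prime p → ∀ x → (1 + x) ^ p % p ≡ (1 + x ^ p) % p
freshman's-dream {p@(suc p′)} pr x = begin
  (1 + x) ^ p % p
    ≡⟨ cong (_% p) (^≡^ (1 + x) p) ⟨
  (1 + x) ℕ-Exp.^ p % p
    ≡⟨ cong (λ s → s ℕ-Exp.^ p % p) (+-comm 1 x) ⟩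
  (x + 1) ℕ-Exp.^ p % p
    ≡⟨ cong (_% p) (ℕ-Binomial.theorem p x 1) ⟩
  (t zero + ℕ-Sum.sum (t ∘ suc)) % p
    -- Splitting off the last term as well leaves in `inner` exactly the indices strictly between 0
    -- and `p`, whose coefficients vanish modulo `p`.
    ≡⟨ cong (λ s → (t zero + s) % p) (ℕ-Sum.sum-init-last (t ∘ suc)) ⟩
  (t zero + (ℕ-Sum.sum inner + t (fromℕ p))) % p
    ≡⟨ +-cong-% p {t zero} {t zero} {_} {t (fromℕ p)} refl
         (%-remove-+ˡ (t (fromℕ p)) (∣sum inner p∣inner)) ⟩
  (t zero + t (fromℕ p)) % p
    ≡⟨ cong₂ (λ u v → (u + v) % p) first last ⟩
  (1 + x ^ p) % p
    ∎
  where
  open ≡-Reasoning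
  t : Fin (suc p) → ℕ
  t = ℕ-Binomial.binomialTerm x 1 p

  inner : Fin p′ → ℕ
  inner = t ∘ suc ∘ inject₁

  term : ∀ k → t k ≡ (p C toℕ k) * x ^ toℕ k
  term k = begin
    t k
      ≡⟨ ×≡* (p C toℕ k) _ ⟩
    (p C toℕ k) * (x ℕ-Exp.^ toℕ k * 1 ℕ-Exp.^ (p ∸ toℕ k))
      ≡⟨ cong₂ (λ u v → (p C toℕ k) * (u * v)) (^≡^ x (toℕ k))
           (trans (^≡^ 1 (p ∸ toℕ k)) (^-zeroˡ (p ∸ toℕ k))) ⟩
    (p C toℕ k) * (x ^ toℕ k * 1)
      ≡⟨ cong ((p C toℕ k) *_) (*-identityʳ _) ⟩
    (p C toℕ k) * x ^ toℕ k
      ∎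

  first : t zero ≡ 1
  first = trans (term zero) (trans (*-identityʳ _) (trans (nCk≡nC[n∸k] {0} {p} z≤n) (nCn≡1 p)))

  last : t (fromℕ p) ≡ x ^ p
  last = begin
    t (fromℕ p)                               ≡⟨ term (fromℕ p) ⟩
    (p C toℕ (fromℕ p)) * x ^ toℕ (fromℕ p)   ≡⟨ cong (λ k → (p C k) * x ^ k) (toℕ-fromℕ p) ⟩
    (p C p) * x ^ p                           ≡⟨ cong (_* x ^ p) (nCn≡1 p) ⟩
    1 * x ^ p                                 ≡⟨ *-identityˡ _ ⟩
    x ^ p                                     ∎

  p∣inner : ∀ i → p ∣ inner i
  p∣inner i = subst (p ∣_) (sym (term (suc (inject₁ i))))
    (∣m⇒∣m*n _ (prime∣C pr z<s (s<s (subst (_< p′) (sym (toℕ-inject₁ i)) (toℕ<n i)))))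

-- Induction on `x`. The form without division by `x` needs no coprimality and suits this induction.
fermat : ∀ {p} .{{_ : NonZero p}} → Prime p → ∀ x → x ^ p % p ≡ x % p
fermat {suc p} pr zero    = refl
fermat {p}     pr (suc x) = trans (freshman's-dream pr x) (+-cong-% p {1} {1} refl (fermat pr x))

-- Fast modular powers and greatest common divisors

-- The first argument of powMod and euclid bounds the recursion depth; the fallback at zero
-- makes both correct for any bound, so it only affects the running time.
powMod : ℕ → ℕ → ℕ → (n : ℕ) .{{_ : NonZero n}} → ℕ
powMod zero    a e n = a ^ e % n
powMod (suc k) a e n = if e ≡ᵇ 0 then 1 % n else step (powMod k a (e / 2) n)
  where
  step : ℕ → ℕ
  step h = (h * h * a ^ (e % 2)) % n

powMod-correct : ∀ k a e n .{{_ : NonZero n}} → powMod k a e n ≡ a ^ e % n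
powMod-correct zero    a e       n = refl
powMod-correct (suc k) a zero    n = refl
powMod-correct (suc k) a e@(suc _) n = begin
  (h * h * a ^ (e % 2)) % n                       ≡⟨ *-cong-% n {h * h} (*-cong-% n {h} h≡ h≡) refl ⟩
  (a ^ (e / 2) * a ^ (e / 2) * a ^ (e % 2)) % n   ≡⟨ cong (_% n) exponents ⟩
  a ^ e % n                                       ∎
  where
  open ≡-Reasoning
  h = powMod k a (e / 2) n
  h≡ : h % n ≡ a ^ (e / 2) % n
  h≡ = trans (cong (_% n) (powMod-correct k a (e / 2) n)) (m%n%n≡m%n (a ^ (e / 2)) n)
  exponents : a ^ (e / 2) * a ^ (e / 2) * a ^ (e % 2) ≡ a ^ e
  exponents = begin
    a ^ (e / 2) * a ^ (e / 2) * a ^ (e % 2)   ≡⟨ cong (_* a ^ (e % 2)) (^-distribˡ-+-* a (e / 2) (e / 2)) ⟨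
    a ^ (e / 2 + e / 2) * a ^ (e % 2)         ≡⟨ ^-distribˡ-+-* a (e / 2 + e / 2) (e % 2) ⟨
    a ^ (e / 2 + e / 2 + e % 2)               ≡⟨ cong (a ^_) (double (e / 2) (e % 2)) ⟩
    a ^ (e % 2 + e / 2 * 2)                   ≡⟨ cong (a ^_) (m≡m%n+[m/n]*n e 2) ⟨
    a ^ e                                     ∎
    where
    double : ∀ u v → u + u + v ≡ v + u * 2
    double = solve-∀

-- This carries a computation modulo `n` over to an unknown divisor `q` of `n`.
powMod-%-∣ : ∀ k a e {n q} .{{_ : NonZero n}} .{{_ : NonZero q}} → q ∣ n →
  powMod k a e n % q ≡ a ^ e % q
powMod-%-∣ k a e {n} {q} q∣n =
  trans (cong (_% q) (powMod-correct k a e n)) (m∣n⇒o%n%m≡o%m q n (a ^ e) q∣n)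

euclid : ℕ → ℕ → ℕ → ℕ
euclid zero    a b       = gcd a b
euclid (suc k) a zero    = a
euclid (suc k) a (suc b) = euclid k (suc b) (a % suc b)

euclid-greatest : ∀ k {a b d} → d ∣ a → d ∣ b → d ∣ euclid k a b
euclid-greatest zero                d∣a d∣b = gcd-greatest d∣a d∣b
euclid-greatest (suc k) {b = zero}  d∣a d∣b = d∣a
euclid-greatest (suc k) {b = suc b} d∣a d∣b = euclid-greatest k d∣b (%-presˡ-∣ d∣a d∣b)

-- Certifying the order of an element

-- Raising x to the power p before recursing keeps the exponents short: the recursive call tests
-- the order of x ^ p against the remaining primes.
orderTest : ℕ → (n : ℕ) .{{_ : NonZero n}} → ℕ → List ℕ → Bool
orderTest k n x []       = x % n ≡ᵇ 1 % n
orderTest k n x (p ∷ ps) =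
  (euclid k n (powMod k x (product ps) n ∸ 1) ≡ᵇ 1) ∧ orderTest k n (powMod k x p n) ps

-- The two conclusions together say that `x` has order exactly `product ps` modulo `q`. By
-- induction, `x ^ p` has order `P`, the product of the remaining primes; the gcd check then lifts
-- this to order `p * P` for `x`.
orderTest-sound : ∀ {k n q x ps} .{{_ : NonZero n}} .{{_ : NonTrivial q}} .{{_ : NonZero q}} →
  q ∣ n → All Prime ps → T (orderTest k n x ps) →
  x ^ product ps % q ≡ 1 % q × (∀ m → x ^ m % q ≡ 1 % q → product ps ∣ m)
orderTest-sound {n = n} {q} {x} q∣n [] x≡ᵇ1 =
  trans (cong (_% q) (*-identityʳ x)) x≡1 , λ m _ → 1∣ m
  where
  open ≡-Reasoning
  x≡1 : x % q ≡ 1 % q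
  x≡1 = begin
    x % q       ≡⟨ m∣n⇒o%n%m≡o%m q n x q∣n ⟨
    x % n % q   ≡⟨ cong (_% q) (≡ᵇ⇒≡ (x % n) (1 % n) x≡ᵇ1) ⟩
    1 % n % q   ≡⟨ m∣n⇒o%n%m≡o%m q n 1 q∣n ⟩
    1 % q       ∎
orderTest-sound {k} {n} {q} {x} {p ∷ ps} q∣n (pr ∷ prs) test = x^pP≡1 , divides-order
  where
  open ≡-Reasoning
  P = product ps
  tests = Equivalence.to T-∧ test
  y = powMod k x p n
  IH = orderTest-sound {k} {n} {q} {y} {ps} q∣n prs (proj₂ tests)

  y≡xᵖ : ∀ m → y ^ m % q ≡ x ^ (p * m) % q
  y≡xᵖ m = trans (^-cong-% q m (powMod-%-∣ k x p q∣n)) (cong (_% q) (^-*-assoc x p m))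

  x^pP≡1 : x ^ (p * P) % q ≡ 1 % q
  x^pP≡1 = trans (sym (y≡xᵖ P)) (proj₁ IH)

  -- Otherwise `q` would divide both `n` and the reduced power minus 1, hence their gcd, which the
  -- test found to be 1.
  x^P≢1 : ¬ (x ^ P % q ≡ 1 % q)
  x^P≢1 x^P≡1 = nonTrivial⇒≢1 (∣1⇒≡1 (subst (q ∣_) (≡ᵇ⇒≡ _ 1 (proj₁ tests))
    (euclid-greatest k q∣n (≡1⇒∣∸1 q (powMod k x P n) (trans (powMod-%-∣ k x P q∣n) x^P≡1)))))

  divides-order : ∀ m → x ^ m % q ≡ 1 % q → p * P ∣ m
  -- The induction hypothesis gives `m = t * P`. If `p` did not divide `t`, the powers of `x ^ P`
  -- with coprime exponents `p` and `t` would both be 1, forcing `x ^ P` to be 1.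
  divides-order m xᵐ≡1 with proj₂ IH m (trans (y≡xᵖ m) (^-*-≡1 q m p xᵐ≡1))
  ... | divides-refl t with p ∣? t
  ...   | yes p∣t = *-monoˡ-∣ P p∣t
  ...   | no  p∤t = contradiction
    (^-coprime-≡1 q {x ^ P} (prime∤⇒coprime pr p∤t) (power p x^pP≡1) (power t xᵐ≡1))
    x^P≢1
    where
    power : ∀ u → x ^ (u * P) % q ≡ 1 % q → (x ^ P) ^ u % q ≡ 1 % q
    power u = trans (cong (_% q) (trans (^-*-assoc x P u) (cong (x ^_) (*-comm P u))))

-- Divisors congruent to 1 modulo `F`

-- Passing from `x ^ q ≡ x` to `x ^ (q ∸ 1) ≡ 1` requires cancelling `x`; a positive power equal to
-- 1 provides the inverse.
≡1⇒fermat : ∀ {q x} .{{_ : NonZero q}} m .{{_ : NonZero m}} → Prime q →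
  x ^ m % q ≡ 1 % q → x ^ (q ∸ 1) % q ≡ 1 % q
≡1⇒fermat {q@(suc q-1)} {x} (suc m) pr xᵐ⁺¹≡1 = begin
  x ^ q-1 % q                    ≡⟨ cong (_% q) (*-identityʳ (x ^ q-1)) ⟨
  (x ^ q-1 * 1) % q              ≡⟨ *-cong-% q {x ^ q-1} {x ^ q-1} {x * x ^ m} {1} refl xᵐ⁺¹≡1 ⟨
  (x ^ q-1 * (x * x ^ m)) % q    ≡⟨ cong (_% q) (swap (x ^ q-1) x (x ^ m)) ⟩
  (x ^ q * x ^ m) % q            ≡⟨ *-cong-% q {x ^ q} {x} {x ^ m} {x ^ m} (fermat pr x) refl ⟩
  (x * x ^ m) % q                ≡⟨ xᵐ⁺¹≡1 ⟩
  1 % q                          ∎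
  where
  open ≡-Reasoning
  swap : ∀ a b c → a * (b * c) ≡ b * a * c
  swap = solve-∀

-- Numbers of the form `1 + a * F` are closed under multiplication, so the property passes from the
-- prime divisors of `n` to their products.
∃≡1mod-product : ∀ {F n} → (∀ {q} → Prime q → q ∣ n → F ∣ q ∸ 1) →
  ∀ {qs} → All Prime qs → product qs ∣ n → ∃[ a ] product qs ≡ 1 + a * F
∃≡1mod-product F∣ []                    _      = 0 , refl
∃≡1mod-product {F} F∣ {q ∷ qs} (pr ∷ prs) qs∣n
  with F∣ pr (m*n∣⇒m∣ q (product qs) qs∣n)
     | ∃≡1mod-product F∣ prs (m*n∣⇒n∣ q (product qs) qs∣n)
... | divides a q-1≡aF | b , Q≡1+bF = a * (1 + b * F) + b , (begin
  q * product qs                     ≡⟨ cong₂ _*_ q≡1+aF Q≡1+bF ⟩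
  (1 + a * F) * (1 + b * F)          ≡⟨ expand a b F ⟩
  1 + (a * (1 + b * F) + b) * F      ∎)
  where
  open ≡-Reasoning
  q≡1+aF : q ≡ 1 + a * F
  q≡1+aF = trans (sym (suc-pred q {{prime⇒nonZero pr}})) (cong suc q-1≡aF)
  expand : ∀ a b F → (1 + a * F) * (1 + b * F) ≡ 1 + (a * (1 + b * F) + b) * F
  expand = solve-∀

∃≡1mod : ∀ {F n} → (∀ {q} → Prime q → q ∣ n → F ∣ q ∸ 1) →
  ∀ {d} .{{_ : NonZero d}} → d ∣ n → ∃[ a ] d ≡ 1 + a * F
∃≡1mod {F} {n} F∣ {d} d∣n = subst (λ d → ∃[ a ] d ≡ 1 + a * F) (sym isFactorisation)
  (∃≡1mod-product F∣ factorsPrime (subst (_∣ n) isFactorisation d∣n))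
  where open PrimeFactorisation (factorise d)

-- Excluding a proper factorisation

m+n≤1+m*n : ∀ m n .{{_ : NonZero m}} .{{_ : NonZero n}} → m + n ≤ 1 + m * n
m+n≤1+m*n (suc m) (suc n) = begin
  -- The slack is the product of the two predecessors.
  suc m + suc n                ≤⟨ m≤m+n _ (m * n) ⟩
  suc m + suc n + m * n        ≡⟨ expand m n ⟩
  1 + suc m * suc n            ∎
  where
  open ≤-Reasoning
  expand : ∀ m n → suc m + suc n + m * n ≡ 1 + suc m * suc n
  expand = solve-∀

base-F-digits : ∀ {F s r} a b → (1 + a * F) * (1 + b * F) ≡ 1 + F * (s * F + r) → r < F →
  a * b * F + (a + b) ≡ s * F + r
base-F-digits {F} {s} {r} a b eq r<F = *-cancelˡ-≡ _ _ F {{>-nonZero (≤-<-trans z≤n r<F)}}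
  (suc-injective (trans (expand a b F) eq))
  where
  expand : ∀ a b F → 1 + F * (a * b * F + (a + b)) ≡ (1 + a * F) * (1 + b * F)
  expand = solve-∀

-- If `a * b` exceeds `s`, then `a * b * F` alone is at least `s * F + F`, beyond `s * F + r`.
-- Otherwise `a + b ≤ 1 + s < r`, and the left side is too small.
no-factorisation : ∀ {F s r} a b .{{_ : NonZero a}} .{{_ : NonZero b}} → suc s < r → r < F →
  (1 + a * F) * (1 + b * F) ≢ 1 + F * (s * F + r)
no-factorisation {F} {s} {r} a b s+1<r r<F eq with <-≤-connex s (a * b)
... | inj₁ s<ab = <⇒≱ r<F (+-cancelˡ-≤ (s * F) F r (begin
  s * F + F               ≡⟨ +-comm (s * F) F ⟩
  suc s * F               ≤⟨ *-monoˡ-≤ F s<ab ⟩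
  a * b * F               ≤⟨ m≤m+n _ (a + b) ⟩
  a * b * F + (a + b)     ≡⟨ base-F-digits {s = s} a b eq r<F ⟩
  s * F + r               ∎))
  where
  open ≤-Reasoning
... | inj₂ ab≤s = <⇒≢ (begin-strict
  a * b * F + (a + b)     ≤⟨ +-mono-≤ (*-monoˡ-≤ F ab≤s) (m+n≤1+m*n a b) ⟩
  s * F + (1 + a * b)     ≤⟨ +-monoʳ-≤ (s * F) (s≤s ab≤s) ⟩
  s * F + suc s           <⟨ +-monoʳ-< (s * F) s+1<r ⟩
  s * F + r               ∎) (base-F-digits {s = s} a b eq r<F)
  where open ≤-Reasoning

pocklington : ∀ {F R s r k a n ps} .{{_ : NonZero n}} → product ps ≡ F → All Prime ps →
  R ≡ s * F + r → suc s < r → r < F → n ≡ 1 + F * R → T (orderTest k n (powMod k a R n) ps) →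
  Prime n
pocklington {F} {R} {s} {r} {k} {a} {n} {ps} refl prs refl s+1<r r<F n≡ test =
  prime {{n>1⇒nonTrivial 1<n}} not-composite
  where
  instance
    F≢0 : NonZero F
    F≢0 = >-nonZero (≤-<-trans z≤n r<F)
    R≢0 : NonZero R
    R≢0 = >-nonZero (<-≤-trans (≤-<-trans z≤n s+1<r) (m≤n+m r (s * F)))

  1<n : 1 < n
  1<n = subst (1 <_) (sym n≡) (s<s (>-nonZero⁻¹ (F * R) {{m*n≢0 F R}}))

  -- Modulo `q` the tested element has order `F`, and Fermat makes its power `q ∸ 1` equal to 1.
  F∣q-1 : ∀ {q} → Prime q → q ∣ n → F ∣ q ∸ 1
  F∣q-1 {q} pr q∣n = proj₂ order (q ∸ 1) (≡1⇒fermat F pr (proj₁ order))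
    where
    instance
      q≢0 = prime⇒nonZero pr
      1<q = prime⇒nonTrivial pr
    order = orderTest-sound {k} {n} {q} q∣n prs test

  nonZero-multiplier : ∀ a {d} → 1 < d → d ≡ 1 + a * F → NonZero a
  nonZero-multiplier zero    1<1 refl = contradiction 1<1 (<-irrefl refl)
  nonZero-multiplier (suc a) _   _    = _

  not-composite : ¬ Composite n
  -- Both `d` and its cofactor `c` exceed 1 and are congruent to 1 modulo `F`, so both multipliers
  -- are nonzero.
  not-composite (composite {d} d<n d∣n@(divides c n≡cd))
    with 1<c ← quotient>1 d∣n d<n
    with ∃≡1mod F∣q-1 {d} {{nonTrivial⇒nonZero d}} d∣n
       | ∃≡1mod F∣q-1 {c} {{>-nonZero (<-trans z<s 1<c)}} (quotient-∣ d∣n)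
  ... | a , d≡1+aF | b , c≡1+bF = no-factorisation b a
    {{nonZero-multiplier b 1<c c≡1+bF}} {{nonZero-multiplier a (nonTrivial⇒n>1 d) d≡1+aF}}
    s+1<r r<F (begin
      (1 + b * F) * (1 + a * F)   ≡⟨ cong₂ _*_ c≡1+bF d≡1+aF ⟨
      c * d                       ≡⟨ n≡cd ⟨
      n                           ≡⟨ n≡ ⟩
      1 + F * R                   ∎)
    where open ≡-Reasoning

-- The criterion as a boolean test

-- Quotients and remainders enter as plain arguments and are checked by multiplication, so soundness
-- needs no facts about division.
criterion : ℕ → (n : ℕ) .{{_ : NonZero n}} → ℕ → List ℕ → (F R s r : ℕ) → Bool
criterion k n a ps F R s r =
  (product ps ≡ᵇ F) ∧ (R ≡ᵇ s * F + r) ∧ (suc s <ᵇ r) ∧ (r <ᵇ F) ∧ (n ≡ᵇ 1 + F * R) ∧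
  orderTest k n (powMod k a R n) ps

criterion-sound : ∀ k n a ps F R s r .{{_ : NonZero n}} → All Prime ps →
  T (criterion k n a ps F R s r) → Prime n
criterion-sound k n a ps F R s r prs test₁ =
  let F≡ , test₂ = to T-∧ test₁
      R≡ , test₃ = to T-∧ test₂
      s+1<r , test₄ = to T-∧ test₃
      r<F , test₅ = to T-∧ test₄
      n≡ , test₆ = to T-∧ test₅
  in pocklington {F} {R} {s} {r} {k} {a} (≡ᵇ⇒≡ _ F F≡) prs (≡ᵇ⇒≡ R _ R≡)
       (<ᵇ⇒< (suc s) r s+1<r) (<ᵇ⇒< r F r<F) (≡ᵇ⇒≡ n _ n≡) test₆
  where open Equivalence

primalityTest : ℕ → ℕ → ℕ → List ℕ → Bool
primalityTest k zero      a ps = false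
primalityTest k n@(suc m) a ps = criterion k n a ps F R (R / suc (pred F)) (R % suc (pred F))
  where
  -- suc (pred F) is a visibly nonzero form of F; criterion rejects F = 0.
  F = product ps
  R = m / suc (pred F)

primalityTest-sound : ∀ k {n ps} a → All Prime ps → T (primalityTest k n a ps) → Prime n
primalityTest-sound k {suc m} {ps} a =
  criterion-sound k (suc m) a ps F R (R / suc (pred F)) (R % suc (pred F))
  where
  F = product ps
  R = m / suc (pred F)

-- Prime certificates

small : ∀ p {_ : True (prime? p)} → Prime p
small p {isPrime} = toWitness isPrime

-- The bound 20000 suffices for numbers of 10500 bits: halving an exponent takes about 10500 steps,
-- and Euclid's algorithm at most about 15130. Once the test evaluates to true, its proof is the
-- unit value, written `_`.
certify : ∀ {n ps} a → All Prime ps → T (primalityTest 20000 n a ps) → Prime n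
certify = primalityTest-sound 20000

-- P⟨d⟩ is a prime with d decimal digits.

P13₁ : Prime 1133836730401
P13₁ = certify 13 (small 31 ∷ small 5 ∷ small 5 ∷ small 3 ∷ small 2 ∷ small 2 ∷ small 2 ∷ []) _

P13₂ : Prime 1864388056649
P13₂ = certify 3 (small 173 ∷ small 13 ∷ small 13 ∷ []) _

P14₁ : Prime 17092196887807
P14₁ = certify 2 (small 53 ∷ small 37 ∷ small 3 ∷ small 3 ∷ small 3 ∷ []) _

P14₂ : Prime 24622230770057
P14₂ = certify 3 (certify {953} 2 (small 17 ∷ []) _ ∷ small 37 ∷ small 2 ∷ []) _

P14₃ : Prime 66769116536501
P14₃ = certify 3 (small 173 ∷ small 7 ∷ small 5 ∷ small 5 ∷ small 2 ∷ []) _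

P15₁ : Prime 168069194932501
P15₁ = certify 10
  (small 5 ∷ small 5 ∷ small 3 ∷ small 3 ∷ small 3 ∷ small 3 ∷ small 3 ∷ small 3 ∷ small 3 ∷
   small 2 ∷ []) _

P15₂ : Prime 199416596687197
P15₂ = certify 11 (certify {1871} 2 (small 17 ∷ []) _ ∷ small 7 ∷ small 3 ∷ small 2 ∷ []) _

P16₁ : Prime 1041815865690181
P16₁ = certify 10
  (certify {509} 2 (small 127 ∷ []) _ ∷ small 3 ∷ small 3 ∷ small 3 ∷ small 3 ∷ small 3 ∷ small 2 ∷
   []) _

P16₂ : Prime 7223591273619001
P16₂ = certify 3 (certify {18104238781} 2 (certify {366631} 2 (small 101 ∷ []) _ ∷ []) _ ∷ []) _

P17₁ : Prime 34010032331525251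
P17₁ = certify 3 (small 223 ∷ small 7 ∷ small 5 ∷ small 5 ∷ small 5 ∷ small 3 ∷ []) _

P17₂ : Prime 41113485425223749
P17₂ = certify 2 (P13₂ ∷ []) _

P17₃ : Prime 88096020226127779
P17₃ = certify 2 (certify {877} 2 (small 73 ∷ []) _ ∷ small 41 ∷ small 31 ∷ []) _

P18 : Prime 129266711542799251
P18 = certify 3 (P14₂ ∷ []) _

P19 : Prime 4710883168879506001
P19 = certify 19
  (small 41 ∷ small 41 ∷ small 5 ∷ small 5 ∷ small 3 ∷ small 3 ∷ small 2 ∷ small 2 ∷ small 2 ∷ []) _

P20₁ : Prime 47970133603445383501
P20₁ = certify 6
  (certify {1483} 2 (small 13 ∷ []) _ ∷ small 19 ∷ small 5 ∷ small 5 ∷ small 3 ∷ small 2 ∷ []) _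

P20₂ : Prime 94291866932171243501
P20₂ = certify 3
  (certify {19192897} 15 (small 3 ∷ small 3 ∷ small 3 ∷ replicate⁺ 4 (small 2)) _ ∷ []) _

P21 : Prime 145029391828892482069
P21 = certify 6
  (certify {2395739} 2 (certify {1129} 2 (small 47 ∷ []) _ ∷ []) _ ∷ small 3 ∷ small 2 ∷ []) _

P22₁ : Prime 2310141222312973778401
P22₁ = certify 17
  (certify {3109} 2 (small 37 ∷ []) _ ∷ small 7 ∷ small 5 ∷ small 5 ∷ small 3 ∷
   replicate⁺ 4 (small 2)) _

P22₂ : Prime 5519485418336288303251
P22₂ = certify 3 (P17₂ ∷ []) _

P23 : Prime 19963778429046466946251
P23 = certify 7
  (certify {7039} 2 (small 23 ∷ small 17 ∷ []) _ ∷ small 5 ∷ small 5 ∷ small 5 ∷ small 5 ∷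
   small 3 ∷ small 3 ∷ []) _

P24₁ : Prime 535347624791488552837151
P24₁ = certify 5
  (certify {331} 3 (small 11 ∷ []) _ ∷ small 137 ∷ small 97 ∷ small 7 ∷ small 5 ∷ []) _

P24₂ : Prime 576056744344360938778069
P24₂ = certify 2 (P21 ∷ []) _

P25 : Prime 1045152523324273849461167
P25 = certify 2
  (certify {262513} 2 (certify {1823} 2 (certify {911} 3 (small 7 ∷ small 5 ∷ []) _ ∷ []) _ ∷ []) _ ∷
   certify {1471} 2 (small 7 ∷ small 7 ∷ []) _ ∷ []) _

P27 : Prime 165134098685235268214864387
P27 = certify 2 (P25 ∷ []) _

P30 : Prime 147805791577364818393554500159
P30 = certify 2 (P24₂ ∷ []) _

P34₁ : Prime 2430065924693517198550322751963101
P34₁ = certify 3 (P15₂ ∷ []) _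

P34₂ : Prime 4028493980595041855367835954324501
P34₂ = certify 3 (P14₁ ∷ []) _

P35 : Prime 35758633131596900685051378954141001
P35 = certify 3 (P27 ∷ []) _

P37 : Prime 1038213793447841940908293355871461401
P37 = certify 37
  (certify {331} 3 (small 11 ∷ []) _ ∷ small 151 ∷ small 41 ∷ small 31 ∷ small 7 ∷ small 5 ∷
   small 5 ∷ small 3 ∷ small 3 ∷ small 3 ∷ small 3 ∷ small 2 ∷ small 2 ∷ []) _

P51 : Prime 181302408105749372353889984109467946688550681222933
P51 = certify 2 (P30 ∷ []) _

P53 : Prime 10152934853921964851817839110130205014558838148484249
P53 = certify 2 (P51 ∷ []) _

P57 : Prime 325985508875527587669607097222667557116221139090131514801
P57 = certify 13
  (certify {3794400427} 2 (certify {28807} 2 (certify {4801} 7 (replicate⁺ 5 (small 2)) _ ∷ []) _ ∷ []) _ ∷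
   certify {123404371} 2 (small 97 ∷ small 5 ∷ small 3 ∷ []) _ ∷ small 5 ∷ small 2 ∷ small 2 ∷
   small 2 ∷ []) _

P58 : Prime 2139731020464054092520609592459940706818275139793055476751
P58 = certify 3 (P53 ∷ []) _

P61 : Prime 1606545773279325100753216665442817637284047671432352410624001
P61 = certify 7
  (certify {8101} 2 (small 5 ∷ small 5 ∷ []) _ ∷
   certify {4051} 3 (small 3 ∷ small 3 ∷ small 3 ∷ []) _ ∷ small 251 ∷ small 101 ∷ small 41 ∷
   small 11 ∷ small 5 ∷ small 5 ∷ small 5 ∷ replicate⁺ 12 (small 2)) _

P69 : Prime 217100085701030760532082456157337409031425675860100163555370465949101
P69 = certify 19
  (P17₃ ∷ certify {461} 2 (small 23 ∷ []) _ ∷ small 5 ∷ small 5 ∷ small 3 ∷ small 3 ∷ small 3 ∷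
   small 2 ∷ small 2 ∷ []) _

-- Φ_5250(2)
P362 : Prime 17218478943235090126032381158173289280004245484499739496610590463333185704775628391399610854894040749225789925699630256047192525282851451195891522334684591467237166374558203484436850479446469875699921122444547376527753111130940278492414499110205297581855515632552396299970110001975144577520361345690090299335022204323827908540210626491006221440892838900400128001
P362 = certify 37
  (P13₁ ∷ certify {3173389601} 3 (certify {6947} 2 (small 151 ∷ []) _ ∷ []) _ ∷
   certify {2789000509} 2 (certify {33202387} 2 (small 7 ∷ small 3 ∷ small 3 ∷ small 3 ∷ small 3 ∷ []) _ ∷ []) _ ∷
   certify {943756589} 2 (certify {235939147} 2 (small 53 ∷ small 53 ∷ []) _ ∷ []) _ ∷
   certify {10567201} 5 (small 37 ∷ small 17 ∷ []) _ ∷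
   certify {2787601} 7 (small 5 ∷ small 5 ∷ small 2 ∷ small 2 ∷ small 2 ∷ []) _ ∷
   certify {2506547} 2 (certify {25577} 2 (small 139 ∷ []) _ ∷ []) _ ∷
   certify {268501} 3 (small 179 ∷ []) _ ∷
   certify {100801} 11 (small 3 ∷ replicate⁺ 5 (small 2)) _ ∷
   certify {61681} 3 (small 257 ∷ []) _ ∷ certify {8101} 2 (small 5 ∷ small 5 ∷ []) _ ∷
   certify {6857} 2 (certify {857} 2 (small 107 ∷ []) _ ∷ []) _ ∷
   certify {4051} 3 (small 3 ∷ small 3 ∷ small 3 ∷ []) _ ∷
   certify {1801} 2 (small 5 ∷ small 5 ∷ []) _ ∷ certify {601} 2 (small 5 ∷ small 5 ∷ []) _ ∷
   certify {401} 2 (small 5 ∷ small 5 ∷ []) _ ∷ certify {331} 3 (small 11 ∷ []) _ ∷ small 251 ∷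
   small 151 ∷ small 101 ∷ small 41 ∷ small 31 ∷ small 17 ∷ small 11 ∷ small 7 ∷ small 5 ∷
   small 5 ∷ small 5 ∷ small 3 ∷ small 3 ∷ replicate⁺ 25 (small 2)) _

theorem4p2 : Prime (W 10501)
-- These odd primes all divide `2 ^ 10500 ∸ 1`; their product is about `10 ^ 1061`, while the cube
-- root of `W 10501` is about `10 ^ 1053.5`. Listing large primes first shortens the remaining
-- exponents soonest.
theorem4p2 = certify 3 (
  P362 ∷ P69 ∷ P61 ∷ P58 ∷ P57 ∷ P37 ∷ P35 ∷ P34₂ ∷ P34₁ ∷ P24₁ ∷ P23 ∷ P22₂ ∷ P22₁ ∷ P20₂ ∷ P20₁ ∷
  P19 ∷ P18 ∷ P17₁ ∷ P16₂ ∷ P16₁ ∷ P15₁ ∷ P14₃ ∷ P13₁ ∷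
  certify {347833278451} 3 (small 211 ∷ small 5 ∷ small 5 ∷ small 3 ∷ []) _ ∷
  certify {269089806001} 17 (small 41 ∷ small 5 ∷ small 5 ∷ small 2 ∷ small 2 ∷ small 2 ∷ []) _ ∷
  certify {259213867501} 6 (small 7 ∷ small 5 ∷ small 5 ∷ small 5 ∷ small 5 ∷ small 2 ∷ []) _ ∷
  certify {247772800801} 41 (small 5 ∷ small 5 ∷ small 3 ∷ small 3 ∷ small 3 ∷ replicate⁺ 4 (small 2)) _ ∷
  certify {146919792181} 3 (certify {57149} 2 (small 157 ∷ []) _ ∷ []) _ ∷
  certify {90984652501} 10 (small 7 ∷ small 5 ∷ small 5 ∷ small 5 ∷ small 5 ∷ small 2 ∷ []) _ ∷ []) _
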